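{- $\overline{\forall}_{\mathsf{is\_prime}}\,\mathsf{sieve}$ holds, i.e., for every $i$, every element of the finite list $\mathsf{idl}\,\mathsf{sieve}\,i$ satisfies $\mathsf{is\_prime}$.
   Context: $\mathsf{colist}\,A$ is the coinductive type with constructors $\bot$ and $\mathsf{cocons}\,a\,l$, ordered coinductively by $\bot\sqsubseteq l$ and $\mathsf{cocons}\,a\,l_1\sqsubseteq\mathsf{cocons}\,a\,l_2$ if $l_1\sqsubseteq l_2$; order-equivalent streams are assumed equal (axiom). $\mathsf{idl}\,s\,0=\mathsf{nil}$, $\mathsf{idl}\,\bot\,(i+1)=\mathsf{nil}$, $\mathsf{idl}(\mathsf{cocons}\,a\,s)(i+1)=\mathsf{cons}\,a\,(\mathsf{idl}\,s\,i)$. For monotone $h:\mathsf{list}\,A\to C$ (lists ordered by prefix), $\overline h(s):=\sup_i h(\mathsf{idl}\,s\,i)$ (chosen supremum). $\mathsf{fold}\,z\,f$: $\mathsf{nil}\mapsto z$, $\mathsf{cons}\,a\,l\mapsto f\,a\,(\mathsf{fold}\,z\,f\,l)$. $\mathsf{filter}\,f:=\overline{\mathsf{fold}\,\bot\,(\lambda a\,l.\,\text{if }f\,a\text{ then }\mathsf{cocons}\,a\,l\text{ else }l)}$. $\mathsf{nats}\,n:=\mathsf{cocons}\,n\,(\mathsf{nats}(n+1))$, $n:\mathbb{Z}$. $\mathsf{sieve\_aux}:=\overline{\mathsf{fold}\,\bot\,(\lambda n\,l.\,\mathsf{cocons}\,n\,(\mathsf{filter}\,(\lambda m.\,m\bmod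 n\ne0)\,l))}$, $\mathsf{sieve}:=\mathsf{sieve\_aux}(\mathsf{nats}\,2)$. $\mathsf{is\_prime}\,n:\iff 1<n\land\forall m,\ 1<m\to n\ne m\to n\bmod m\ne0$. For $P:A\to\mathbb{P}$, $\overline{\forall}_P\,s:\iff\forall i,\ \mathsf{fold}\,\top\,(\lambda a\,Q.\,P\,a\land Q)\,(\mathsf{idl}\,s\,i)$ (the cocontinuous extension into $\mathbb{P}$, whose infima are universals). -}

module Defs where

open import Level using (Level)
open import Data.Nat using (ℕ; zero; suc)
open import Data.Integer using (ℤ; +_; +[1+_]; -[1+_]; _+_; _<_; _%_)
open import Data.Maybe using (Maybe; just; nothing)
open import Data.List using (List; []; _∷_)
open import Data.Product using (_×_)
open import Data.Unit using (⊤)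
open import Data.Empty using (⊥)
open import Relation.Binary.PropositionalEquality using (_≡_; _≢_; refl)
open import Relation.Nullary using (¬_)
open import Relation.Nullary.Decidable using (⌊_⌋)
open import Data.Bool using (Bool; if_then_else_; not)
import Data.Integer as ℤ

-- colist A : the final coalgebra of  X ↦ ⊥ | cocons A X.
-- (Coinductive records need --guardedness, which is not allowed here, so
-- we use the standard observational encoding: the observation at depth i
-- is 'nothing' if ⊥ has been reached by then, and 'just a' if the i-th
-- constructor is cocons a _; once ⊥ is reached it stays ⊥.)

record Colist (A : Set) : Set where
  constructor mkColist
  field
    at     : ℕ → Maybe A
    closed : ∀ i → at i ≡ nothing → at (suc i) ≡ nothing
open Colist public

bot : {A : Set} → Colist A
bot = mkColist (λ _ → nothing) (λ _ _ → refl)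

cocons : {A : Set} → A → Colist A → Colist A
cocons {A} a l = mkColist f c
  where
  f : ℕ → Maybe A
  f zero    = just a
  f (suc i) = at l i
  c : ∀ i → f i ≡ nothing → f (suc i) ≡ nothing
  c zero    ()
  c (suc i) e = closed l i e

-- The coinductive order (⊥ ⊑ l ; cocons a l₁ ⊑ cocons a l₂ if l₁ ⊑ l₂),
-- unfolded: at every depth, s is ⊥ or shows the same head as t.
_⊑_ : {A : Set} → Colist A → Colist A → Set
s ⊑ t = ∀ i a → at s i ≡ just a → at t i ≡ just a

OrderExtensional : Set → Set
OrderExtensional A = (s t : Colist A) → s ⊑ t → t ⊑ s → s ≡ t

idl : {A : Set} → Colist A → ℕ → List A
idl s zero = []
idl s (suc i) with at s 0
... | nothing = []
... | just a  = a ∷ idl (mkColist (λ k → at s (suc k)) (λ k → closed s (suc k))) i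

IsChain : {A : Set} → (ℕ → Colist A) → Set
IsChain c = ∀ i → c i ⊑ c (suc i)

IsChainSup : {A : Set} → ((ℕ → Colist A) → Colist A) → Set
IsChainSup {A} sup =
  (c : ℕ → Colist A) → IsChain c →
    ((∀ i → c i ⊑ sup c) × (∀ (u : Colist A) → (∀ i → c i ⊑ u) → sup c ⊑ u))

ext : {A C : Set} → ((ℕ → C) → C) → (List A → C) → Colist A → C
ext sup h s = sup (λ i → h (idl s i))

fold : {a b : Level} {A : Set a} {B : Set b} → B → (A → B → B) → List A → B
fold z f []       = z
fold z f (a ∷ l)  = f a (fold z f l)

filter : {A : Set} → ((ℕ → Colist A) → Colist A) → (A → Bool) → Colist A → Colist A
filter sup f = ext sup (fold bot (λ a l → if f a then cocons a l else l))

-- nats n = cocons n (nats (n + 1)), i.e. the colist n, n+1, n+2, ...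
nats : ℤ → Colist ℤ
nats n = mkColist (λ i → just (n + + i)) (λ _ ())

-- m mod n (Euclidean remainder; m mod 0 = m)
_mod_ : ℤ → ℤ → ℤ
m mod (+ zero)    = m
m mod +[1+ k ]    = + (m % +[1+ k ])
m mod -[1+ k ]    = + (m % -[1+ k ])

notDivBy : ℤ → ℤ → Bool
notDivBy n m = not ⌊ (m mod n) ℤ.≟ + 0 ⌋

sieveAux : ((ℕ → Colist ℤ) → Colist ℤ) → Colist ℤ → Colist ℤ
sieveAux sup = ext sup (fold bot (λ n l → cocons n (filter sup (notDivBy n) l)))

sieve : ((ℕ → Colist ℤ) → Colist ℤ) → Colist ℤ
sieve sup = sieveAux sup (nats (+ 2))

isPrime : ℤ → Set
isPrime n = (+ 1 < n) × (∀ m → + 1 < m → n ≢ m → (n mod m) ≢ + 0)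

forallBar : {A : Set} → (A → Set) → Colist A → Set
forallBar P s = ∀ i → fold ⊤ (λ a Q → P a × Q) (idl s i)

-- The sieve only ever outputs an element y of  nats 2  after it has survived
-- the filters of every smaller element of  nats 2 , so every output y ≥ 2 has
-- no divisor m with 2 ≤ m < y, i.e. it is prime.  On the finite approximations
-- sieveAux (2 ∷ 3 ∷ … ∷ (i+1)) this invariant is proved by induction; it passes
-- to the chosen suprema because a supremum contains no element that does not
-- already occur in the chain: otherwise truncating the supremum just before
-- that element would give a smaller upper bound.
module Submission where

open import Defs
open import Data.Integer using (ℤ)
open import Data.Nat using (ℕ)

open import Data.Bool using (Bool; true; false; if_then_else_)
open import Data.Empty using (⊥-elim)
open import Function using (_∘_)
open import Data.Integer as ℤ using (+_; +[1+_]; -[1+_]; _+_; +≤+; +<+)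
import Data.Integer.Properties as ℤ
open import Data.List using (List; []; _∷_)
open import Data.List.Relation.Binary.Prefix.Heterogeneous using (Prefix; []; _∷_)
open import Data.Maybe using (just; nothing)
open import Data.Maybe.Properties using (just-injective)
open import Data.Nat as ℕ using (zero; suc; s≤s; z≤n)
import Data.Nat.DivMod as ℕ
import Data.Nat.Properties as ℕ
open import Data.Product using (_×_; _,_; ∃; proj₁; proj₂)
open import Data.Sum using (inj₁; inj₂)
open import Data.Unit using (⊤; tt)
open import Relation.Binary using (tri<; tri≈; tri>)
open import Relation.Binary.PropositionalEquality
open import Relation.Nullary using (¬_; Dec; yes; no; contradiction)
open import Relation.Unary using (Stable)

private
  variable
    A : Set

_≼_ : List A → List A → Set
_≼_ = Prefix _≡_

tl : Colist A → Colist A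
tl s = mkColist (λ k → at s (suc k)) (λ k → closed s (suc k))

⊑-trans : {s t u : Colist A} → s ⊑ t → t ⊑ u → s ⊑ u
⊑-trans s⊑t t⊑u i a e = t⊑u i a (s⊑t i a e)

bot-⊑ : {t : Colist A} → bot ⊑ t
bot-⊑ i a ()

cocons-mono : {a : A} {s t : Colist A} → s ⊑ t → cocons a s ⊑ cocons a t
cocons-mono s⊑t zero    b e = e
cocons-mono s⊑t (suc i) b e = s⊑t i b e

at-just-≤ : (s : Colist A) {k j : ℕ} {a : A} →
            k ℕ.≤ j → at s j ≡ just a → ∃ λ b → at s k ≡ just b
at-just-≤ s {j = j} {a} k≤j e with ℕ.m≤n⇒m<n∨m≡n k≤j
... | inj₂ refl = a , e
at-just-≤ s {j = suc j} k≤j e | inj₁ (s≤s k≤j′) with at s j in e′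
... | just b  = at-just-≤ s k≤j′ e′
... | nothing = contradiction (trans (sym e) (closed s j e′)) λ ()

-- forallBar P s is definitionally ∀ i → ListAll P (idl s i).

ListAll : (A → Set) → List A → Set
ListAll P = fold ⊤ (λ a Q → P a × Q)

Every : (A → Set) → Colist A → Set
Every P s = ∀ k {y} → at s k ≡ just y → P y

every-bot : {P : A → Set} → Every P bot
every-bot k ()

every-cocons : {P : A → Set} {a : A} {t : Colist A} → P a → Every P t → Every P (cocons a t)
every-cocons pa pt zero    refl = pa
every-cocons pa pt (suc k) e    = pt k e

idl-listAll : {P : A → Set} (s : Colist A) → Every P s → ∀ i → ListAll P (idl s i)
idl-listAll s ps zero = tt
idl-listAll s ps (suc i) with at s 0 in e
... | nothing = tt
... | just a  = ps 0 e , idl-listAll (tl s) (λ k → ps (suc k)) i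

idl-mono : {s t : Colist A} → s ⊑ t → ∀ i → idl s i ≼ idl t i
idl-mono s⊑t zero = []
idl-mono {s = s} {t} s⊑t (suc i) with at s 0 in e
... | nothing = []
... | just a with at t 0 | s⊑t 0 a e
...   | .(just a) | refl = refl ∷ idl-mono {s = tl s} {tl t} (λ j → s⊑t (suc j)) i

idl-≼-suc : (s : Colist A) → ∀ i → idl s i ≼ idl s (suc i)
idl-≼-suc s zero = []
idl-≼-suc s (suc i) with at s 0
... | nothing = []
... | just a  = refl ∷ idl-≼-suc (tl s) i

truncateAt : Colist A → ℕ → Colist A
truncateAt {A} s k = mkColist observe stays-closed
  where
  observe : ℕ → _
  observe j with j ℕ.<? k
  ... | yes _ = at s j
  ... | no _  = nothing
  stays-closed : ∀ j → observe j ≡ nothing → observe (suc j) ≡ nothing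
  stays-closed j e with j ℕ.<? k | suc j ℕ.<? k
  ... | yes _   | yes _    = closed s j e
  ... | _       | no _     = refl
  ... | no j≮k  | yes j+1<k = contradiction (ℕ.<-trans (ℕ.n<1+n j) j+1<k) j≮k

at-truncateAt-< : (s : Colist A) {k j : ℕ} → j ℕ.< k → at (truncateAt s k) j ≡ at s j
at-truncateAt-< s {k} {j} j<k with j ℕ.<? k
... | yes _   = refl
... | no j≮k  = contradiction j<k j≮k

at-truncateAt-self : (s : Colist A) (k : ℕ) → at (truncateAt s k) k ≡ nothing
at-truncateAt-self s k with k ℕ.<? k
... | yes k<k = contradiction k<k (ℕ.<-irrefl refl)
... | no _    = refl

module _ (sup : (ℕ → Colist A) → Colist A) (isSup : IsChainSup sup) where

  -- If y at depth k of sup c were not P, no c i could reach depth k (its entry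
  -- there is y), so truncateAt (sup c) k would be an upper bound strictly
  -- below sup c.
  sup-every : {P : A → Set} → Stable P → (c : ℕ → Colist A) → IsChain c →
              (∀ i → Every P (c i)) → Every P (sup c)
  sup-every {P} stable c chain pc k {y} e = stable y ¬¬Py
    where
    upper : ∀ i → c i ⊑ sup c
    upper = proj₁ (isSup c chain)
    least : ∀ u → (∀ i → c i ⊑ u) → sup c ⊑ u
    least = proj₂ (isSup c chain)

    below-truncation : ¬ P y → ∀ i → c i ⊑ truncateAt (sup c) k
    below-truncation ¬Py i j a e′ = by-cases (j ℕ.<? k)
      where
      by-cases : Dec (j ℕ.< k) → at (truncateAt (sup c) k) j ≡ just a
      by-cases (yes j<k) = trans (at-truncateAt-< (sup c) j<k) (upper i j a e′)
      by-cases (no j≮k)  with at-just-≤ (c i) (ℕ.≮⇒≥ j≮k) e′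
      ... | b , eb = contradiction
        (subst P (just-injective (trans (sym (upper i k b eb)) e)) (pc i k eb)) ¬Py

    ¬¬Py : ¬ ¬ P y
    ¬¬Py ¬Py with trans (sym (least (truncateAt (sup c) k) (below-truncation ¬Py) k y e))
                        (at-truncateAt-self (sup c) k)
    ... | ()

  Monotone : (List A → Colist A) → Set
  Monotone h = ∀ {l l′} → l ≼ l′ → h l ⊑ h l′

  ext-chain : (h : List A → Colist A) → Monotone h → (s : Colist A) →
              IsChain (λ i → h (idl s i))
  ext-chain h h-mono s i = h-mono (idl-≼-suc s i)

  ext-mono : (h : List A → Colist A) → Monotone h → {s t : Colist A} →
             s ⊑ t → ext sup h s ⊑ ext sup h t
  ext-mono h h-mono {s} {t} s⊑t =
    proj₂ (isSup _ (ext-chain h h-mono s)) (ext sup h t) λ i →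
      ⊑-trans {s = h (idl s i)} {h (idl t i)} {ext sup h t}
        (h-mono (idl-mono {s = s} s⊑t i)) (proj₁ (isSup _ (ext-chain h h-mono t)) i)

  ext-every : {P : A → Set} → Stable P → (h : List A → Colist A) → Monotone h →
              (s : Colist A) → (∀ i → Every P (h (idl s i))) → Every P (ext sup h s)
  ext-every stable h h-mono s = sup-every stable _ (ext-chain h h-mono s)

  module _ (f : A → Bool) where

    filterList : List A → Colist A
    filterList = fold bot (λ a l → if f a then cocons a l else l)

    filterList-mono : Monotone filterList
    filterList-mono {l′ = l′} [] = bot-⊑ {t = filterList l′}
    filterList-mono (_∷_ {a = a} refl p) with f a
    ... | true  = cocons-mono (filterList-mono p)
    ... | false = filterList-mono p

    filterList-every : {P : A → Set} (l : List A) →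
                       ListAll (λ y → f y ≡ true → P y) l → Every P (filterList l)
    filterList-every [] _ = every-bot
    filterList-every (a ∷ l) (pa , pl) with f a
    ... | true  = every-cocons (pa refl) (filterList-every l pl)
    ... | false = filterList-every l pl

    filter-mono : {s t : Colist A} → s ⊑ t → filter sup f s ⊑ filter sup f t
    filter-mono = ext-mono filterList filterList-mono

    filter-every : {P : A → Set} → Stable P → (s : Colist A) →
                   Every (λ y → f y ≡ true → P y) s → Every P (filter sup f s)
    filter-every stable s ps = ext-every stable filterList filterList-mono s λ i →
      filterList-every (idl s i) (idl-listAll s ps i)

range : ℤ → ℕ → List ℤ
range a zero    = []
range a (suc n) = a ∷ range (ℤ.suc a) n

-- Stated for any s counting up from a, as tl (nats a) is not definitionally nats (ℤ.suc a).
idl-from : (s : Colist ℤ) (a : ℤ) → (∀ k → at s k ≡ just (a + + k)) →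
           ∀ i → idl s i ≡ range a i
idl-from s a s-from zero = refl
idl-from s a s-from (suc i) with at s 0 | s-from 0
... | .(just (a + + 0)) | refl =
  cong₂ _∷_ (ℤ.+-identityʳ a) (idl-from (tl s) (ℤ.suc a) tl-from i)
  where
  tl-from : ∀ k → at s (suc k) ≡ just (ℤ.suc a + + k)
  tl-from k = trans (s-from (suc k)) (cong just (begin
    a + + suc k       ≡⟨ sym (ℤ.+-assoc a (+ 1) (+ k)) ⟩
    a + + 1 + + k     ≡⟨ cong (λ x → x + + k) (ℤ.+-comm a (+ 1)) ⟩
    ℤ.suc a + + k     ∎))
    where open ≡-Reasoning

Sifted : ℤ → ℤ → Set
Sifted a y = a ℤ.≤ y × (∀ m → a ℤ.≤ m → m ℤ.< y → y mod m ≢ + 0)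

sifted-stable : ∀ a → Stable (Sifted a)
sifted-stable a y ¬¬sifted with a ℤ.≤? y
... | no a≰y  = ⊥-elim (¬¬sifted λ sifted → a≰y (proj₁ sifted))
... | yes a≤y = a≤y , λ m a≤m m<y y%m≡0 → ¬¬sifted λ sifted → proj₂ sifted m a≤m m<y y%m≡0

notDivBy-true : ∀ n y → notDivBy n y ≡ true → y mod n ≢ + 0
notDivBy-true n y e with y mod n ℤ.≟ + 0
... | no y%n≢0 = y%n≢0

sifted-suc : ∀ a y → Sifted (ℤ.suc a) y → notDivBy a y ≡ true → Sifted a y
sifted-suc a y (a+1≤y , sifted) survives = ℤ.≤-trans (ℤ.i≤suc[i] a) a+1≤y , by-cases
  where
  by-cases : ∀ m → a ℤ.≤ m → m ℤ.< y → y mod m ≢ + 0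
  by-cases m a≤m m<y with m ℤ.≟ a
  ... | yes refl = notDivBy-true a y survives
  ... | no m≢a   = sifted m (ℤ.i<j⇒suc[i]≤j (ℤ.≤∧≢⇒< a≤m (m≢a ∘ sym))) m<y

sieveList : ((ℕ → Colist ℤ) → Colist ℤ) → List ℤ → Colist ℤ
sieveList sup = fold bot (λ n l → cocons n (filter sup (notDivBy n) l))

module _ (sup : (ℕ → Colist ℤ) → Colist ℤ) (isSup : IsChainSup sup) where

  sieveList-mono : Monotone sup isSup (sieveList sup)
  sieveList-mono {l′ = l′} [] = bot-⊑ {t = sieveList sup l′}
  sieveList-mono (_∷_ {a = n} refl p) =
    cocons-mono (filter-mono sup isSup (notDivBy n) (sieveList-mono p))

  sieveList-range : ∀ n a → Every (Sifted a) (sieveList sup (range a n))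
  sieveList-range zero    a = every-bot
  sieveList-range (suc n) a = every-cocons (ℤ.≤-refl , a-sifted)
    (filter-every sup isSup (notDivBy a) (sifted-stable a) _ λ k e →
       sifted-suc a _ (sieveList-range n (ℤ.suc a) k e))
    where
    a-sifted : ∀ m → a ℤ.≤ m → m ℤ.< a → a mod m ≢ + 0
    a-sifted m a≤m m<a = contradiction (ℤ.≤-<-trans a≤m m<a) (ℤ.<-irrefl refl)

sifted⇒isPrime : ∀ y → Sifted (+ 2) y → isPrime y
sifted⇒isPrime .(+ n) (+≤+ {n = n} 2≤n , sifted) = +<+ 2≤n , no-proper-divisor
  where
  no-proper-divisor : ∀ m → + 1 ℤ.< m → + n ≢ m → (+ n) mod m ≢ + 0
  no-proper-divisor -[1+ _ ]   ()
  no-proper-divisor (+ zero)   (+<+ ())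
  no-proper-divisor m@(+[1+ k ]) 1<m n≢m with ℤ.<-cmp m (+ n)
  ... | tri< m<n _ _ = sifted m (ℤ.i<j⇒suc[i]≤j 1<m) m<n
  ... | tri≈ _ m≡n _ = contradiction (sym m≡n) n≢m
  ... | tri> _ _ (+<+ n<m) = λ n%m≡0 → contradiction
    (trans (sym (ℕ.m<n⇒m%n≡m n<m)) (ℤ.+-injective n%m≡0)) (ℕ.>⇒≢ (ℕ.<-trans (s≤s z≤n) 2≤n))

mainTheorem8 : (sup : (ℕ → Colist ℤ) → Colist ℤ) → IsChainSup sup → OrderExtensional ℤ →
    forallBar isPrime (sieve sup)
mainTheorem8 sup isSup _ = idl-listAll (sieve sup) sieve-prime
  where
  approximations-sifted : ∀ i → Every (Sifted (+ 2)) (sieveList sup (idl (nats (+ 2)) i))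
  approximations-sifted i rewrite idl-from (nats (+ 2)) (+ 2) (λ _ → refl) i =
    sieveList-range sup isSup i (+ 2)

  sieve-sifted : Every (Sifted (+ 2)) (sieve sup)
  sieve-sifted = ext-every sup isSup (sifted-stable (+ 2))
    (sieveList sup) (sieveList-mono sup isSup) (nats (+ 2)) approximations-sifted

  sieve-prime : Every isPrime (sieve sup)
  sieve-prime k e = sifted⇒isPrime _ (sieve-sifted k e)
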